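{- Let $k\ge 2$ and $r\ge 1$ be integers with $r\le k$. Then $$\sum_{s\mid (k,r)}\binom{k/s}{r/s}\mu(s)\equiv 0\pmod{k},$$ where the sum is over all positive divisors $s$ of the greatest common divisor $(k,r)$.
   Context: $(k,r)$ denotes the greatest common divisor of $k$ and $r$, and $\mu$ the Möbius function. -}

module Defs where

open import Data.Integer.Base using (ℤ; 0ℤ; -1ℤ; _+_; _^_)
open import Data.List.Base using (List; length; map; foldr; filter; upTo)
open import Data.List.Relation.Unary.Unique.DecPropositional using (unique?)
open import Data.Nat.Base using (ℕ; suc; NonZero)
open import Data.Nat.Divisibility using (_∣?_)
open import Data.Nat.Primality.Factorisation using (factorise; factors)
open import Data.Nat.Properties using (_≟_)
open import Data.Bool.Base using (if_then_else_)
open import Relation.Nullary.Decidable.Core using (does)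

-- The Möbius function. `factors` lists prime factors with multiplicity, so
-- it is repetition-free exactly when n is squarefree.

μ : (n : ℕ) .{{_ : NonZero n}} → ℤ
μ n = if does (unique? _≟_ ps) then -1ℤ ^ length ps else 0ℤ
  where
  ps : List ℕ
  ps = factors (factorise n)

sum : List ℤ → ℤ
sum = foldr _+_ 0ℤ

-- The sum of f s over the positive divisors s of n. Since s must be nonzero,
-- i ranges over 0, …, n - 1 and s = suc i. (For n = 0 the sum is empty; this
-- is meant to be used for n ≥ 1.)

∑-divisors : (n : ℕ) → ((s : ℕ) .{{_ : NonZero s}} → ℤ) → ℤ
∑-divisors n f = sum (map (λ i → f (suc i)) (filter (λ i → suc i ∣? n) (upTo n)))

{-# OPTIONS --safe #-}
module Submission where

-- It suffices to find, for every prime p, a multiplier c prime to p such that k ∣ c S, where S is the sum: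
-- these multipliers are all divisible by k / gcd(k, S), which therefore has no prime factor.
-- If p ∤ k then c = k works, and if p ∤ r then c = r works for each summand, since k C(k−1, r−1) = r C(k, r).
-- If p ∣ (k, r), only the divisors s and s p with p ∤ s contribute, and since μ(s p) = −μ(s) each such pair
-- reduces to C(a p, b p) ≡ C(a, b) modulo a p, locally at p, where k = a p s and r = b p s.
-- That congruence follows by cancelling the factors divisible by p in the product formula for C(a p, b p):
-- the remaining factors a p − i and i of numerator and denominator agree modulo a p up to sign.

open import Defs
open import Data.Nat.Base using (ℕ; _≤_; _/_)
open import Data.Nat.Combinatorics using (_C_)
open import Data.Nat.GCD using (gcd)
open import Data.Integer.Base using (+_; _*_)
open import Data.Integer.Divisibility.Signed using (_∣_)

open import Data.Bool.Base using (true; false; if_then_else_)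
open import Data.Integer.Base using (ℤ; -_; _+_; _-_; _^_; 0ℤ; 1ℤ; -1ℤ; ∣_∣)
open import Data.Integer.Divisibility.Signed
  using (divides; ∣-refl; ∣ᵤ⇒∣; ∣⇒∣ᵤ; ∣m∣n⇒∣m+n; ∣m∣n⇒∣m-n; ∣n⇒∣m*n; ∣m⇒∣m*n; *-monoˡ-∣)
import Data.Integer.Properties as ℤ
open import Data.Integer.Tactic.RingSolver using (solve-∀)
open import Data.List.Base using (List; []; _∷_; applyUpTo; filter; length; map)
open import Data.List.Membership.Propositional using (_∈_)
open import Data.List.Relation.Binary.Permutation.Propositional using (_↭_; ↭⇒↭ₛ; ↭-sym)
open import Data.List.Relation.Binary.Permutation.Propositional.Properties using (↭-length)
import Data.List.Relation.Binary.Permutation.Setoid.Properties as Permutation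
open import Data.List.Relation.Unary.All using (_∷_)
open import Data.List.Relation.Unary.All.Properties using (¬Any⇒All¬; All¬⇒¬Any)
open import Data.List.Relation.Unary.AllPairs using (_∷_; tail)
open import Data.Nat.Base as ℕ using (zero; suc; NonZero)
open import Data.Nat.Combinatorics using (nCk+nC[k+1]≡[n+1]C[k+1]; nC1≡n; nCn≡1; nCk≡nC[n∸k]; k>n⇒nCk≡0)
open import Data.Nat.Coprimality using (Coprime; coprime-/gcd; coprime-divisor)
import Data.Nat.Divisibility as ℕ
import Data.Nat.DivMod as ℕ
open import Data.Nat.GCD using (gcd[m,n]∣m; gcd[m,n]∣n; gcd-greatest; gcd[m,n]≢0)
open import Data.Nat.ListAction.Properties using (∈⇒∣product)
open import Data.Nat.Primality using (Prime; euclidsLemma; ¬prime[0]; ¬prime[1]; prime⇒irreducible)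
open import Data.Nat.Primality.Factorisation
  using (PrimeFactorisation; factors; factorise; factorisationUnique; factorisationHasAllPrimeFactors)
import Data.Nat.Properties as ℕ
import Data.Nat.Tactic.RingSolver as ℕ
open import Data.Product.Base using (∃; ∃₂; _×_; _,_)
open import Data.Sum.Base as Sum using (_⊎_; inj₁; inj₂; [_,_]′)
open import Function.Base using (_∘_; id)
open import Function.Bundles using (mk⇔)
open import Relation.Binary.PropositionalEquality
  using (_≡_; _≢_; refl; sym; trans; cong; cong₂; subst; subst₂; setoid; module ≡-Reasoning)
open import Relation.Nullary using (¬_; Dec; yes; no; does; ¬?; contradiction)
open import Relation.Nullary.Decidable using (does-⇔; dec-true; dec-false)
open import Relation.Unary using (Pred; Decidable)
open import Data.List.Relation.Unary.Unique.DecPropositional ℕ._≟_ using (Unique; unique?)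

open PrimeFactorisation using (isFactorisation; factorsPrime)

-- Binomial coefficients: the absorption identity.

nC0≡1 : ∀ n → n C 0 ≡ 1
nC0≡1 n = trans (nCk≡nC[n∸k] {0} {n} ℕ.z≤n) (nCn≡1 n)

-- Induction on `n`: Pascal's rule on the left, the hypothesis at `k` and at `suc k`, then Pascal's
-- rule again to collect the right.
[k+1]*[n+1]C[k+1]≡[n+1]*nCk : ∀ n k → suc k ℕ.* (suc n C suc k) ≡ suc n ℕ.* (n C k)
[k+1]*[n+1]C[k+1]≡[n+1]*nCk n zero = begin
  1 ℕ.* (suc n C 1)    ≡⟨ ℕ.*-identityˡ _ ⟩
  suc n C 1            ≡⟨ nC1≡n (suc n) ⟩
  suc n                ≡⟨ ℕ.*-identityʳ (suc n) ⟨
  suc n ℕ.* 1          ≡⟨ cong (suc n ℕ.*_) (nC0≡1 n) ⟨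
  suc n ℕ.* (n C 0)    ∎
  where open ≡-Reasoning
[k+1]*[n+1]C[k+1]≡[n+1]*nCk zero (suc k) = begin
  suc (suc k) ℕ.* (1 C suc (suc k))
    ≡⟨ cong (suc (suc k) ℕ.*_) (k>n⇒nCk≡0 {1} {suc (suc k)} (ℕ.s≤s (ℕ.s≤s ℕ.z≤n))) ⟩
  suc (suc k) ℕ.* 0
    ≡⟨ ℕ.*-zeroʳ (suc (suc k)) ⟩
  0
    ≡⟨ cong (1 ℕ.*_) (k>n⇒nCk≡0 {0} {suc k} (ℕ.s≤s ℕ.z≤n)) ⟨
  1 ℕ.* (0 C suc k)                 ∎
  where open ≡-Reasoning
[k+1]*[n+1]C[k+1]≡[n+1]*nCk (suc n) (suc k) = begin
  suc (suc k) ℕ.* (suc (suc n) C suc (suc k))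
    ≡⟨ cong (suc (suc k) ℕ.*_) (nCk+nC[k+1]≡[n+1]C[k+1] (suc n) (suc k)) ⟨
  suc (suc k) ℕ.* (a ℕ.+ b)
    ≡⟨ expand k a b ⟩
  a ℕ.+ (suc k ℕ.* a ℕ.+ suc (suc k) ℕ.* b)
    ≡⟨ cong (a ℕ.+_) (cong₂ ℕ._+_ ([k+1]*[n+1]C[k+1]≡[n+1]*nCk n k) ([k+1]*[n+1]C[k+1]≡[n+1]*nCk n (suc k))) ⟩
  a ℕ.+ (suc n ℕ.* (n C k) ℕ.+ suc n ℕ.* (n C suc k))
    ≡⟨ cong (a ℕ.+_) (ℕ.*-distribˡ-+ (suc n) (n C k) (n C suc k)) ⟨
  a ℕ.+ suc n ℕ.* (n C k ℕ.+ n C suc k)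
    ≡⟨ cong (λ c → a ℕ.+ suc n ℕ.* c) (nCk+nC[k+1]≡[n+1]C[k+1] n k) ⟩
  suc (suc n) ℕ.* a ∎
  where
  open ≡-Reasoning
  a = suc n C suc k
  b = suc n C suc (suc k)
  expand : ∀ k a b → suc (suc k) ℕ.* (a ℕ.+ b) ≡ a ℕ.+ (suc k ℕ.* a ℕ.+ suc (suc k) ℕ.* b)
  expand = ℕ.solve-∀

n∣k*nCk : ∀ n k → n ℕ.∣ k ℕ.* (n C k)
n∣k*nCk n       zero    = n ℕ.∣0
n∣k*nCk zero    (suc k) = ℕ.∣n⇒∣m*n (suc k) (ℕ.∣-reflexive (sym (k>n⇒nCk≡0 {0} {suc k} (ℕ.s≤s ℕ.z≤n))))
n∣k*nCk (suc n) (suc k) = subst (suc n ℕ.∣_) (sym ([k+1]*[n+1]C[k+1]≡[n+1]*nCk n k)) (ℕ.m∣m*n (n C k))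

-- Product formulas for binomial coefficients over the integers.

infix 8 _Cℤ_
_Cℤ_ : ℕ → ℕ → ℤ
n Cℤ k = + (n C k)

-- Over ℤ this holds for all k, since both sides vanish when k ≥ n.
Cℤ-suc : ∀ n k → n Cℤ suc k * + suc k ≡ n Cℤ k * (+ n - + k)
Cℤ-suc n k = begin
  b * + suc k                          ≡⟨ rearrange a b (+ suc k) ⟩
  + suc k * (a + b) - a * + suc k      ≡⟨ cong (_- a * + suc k) absorb ⟩
  + suc n * a - a * + suc k            ≡⟨ collect (+ n) (+ k) a ⟩
  a * (+ n - + k)                      ∎
  where
  open ≡-Reasoning
  a = n Cℤ k
  b = n Cℤ suc k
  absorb : + suc k * (a + b) ≡ + suc n * a
  absorb = begin
    + suc k * (a + b)                  ≡⟨ cong (λ c → + suc k * + c) (nCk+nC[k+1]≡[n+1]C[k+1] n k) ⟩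
    + suc k * + (suc n C suc k)        ≡⟨ ℤ.pos-* (suc k) _ ⟨
    + (suc k ℕ.* (suc n C suc k))      ≡⟨ cong +_ ([k+1]*[n+1]C[k+1]≡[n+1]*nCk n k) ⟩
    + (suc n ℕ.* (n C k))              ≡⟨ ℤ.pos-* (suc n) _ ⟩
    + suc n * a                        ∎
  rearrange : ∀ a b c → b * c ≡ c * (a + b) - a * c
  rearrange = solve-∀
  collect : ∀ n k a → (1ℤ + n) * a - a * (1ℤ + k) ≡ a * (n - k)
  collect = solve-∀

-- The products (x + 1) ⋯ (x + q) and (x - 1) ⋯ (x - q). Both leave out x, so for p ∣ x and q = p -
-- 1 they consist of the factors strictly between two neighbouring multiples of p.
rising falling : ℤ → ℕ → ℤ
rising  x zero    = 1ℤ
rising  x (suc q) = rising x q * (x + + suc q)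
falling x zero    = 1ℤ
falling x (suc q) = falling x q * (x - + suc q)

-- This iterates `Cℤ-suc` over `suc q` steps. The factors `suc q + k` and n - k stand apart because
-- they are the ones divisible by p = `suc q` when p divides n and k.
Cℤ-+ : ∀ n k q →
  n Cℤ (suc q ℕ.+ k) * (rising (+ k) q * + (suc q ℕ.+ k)) ≡ n Cℤ k * ((+ n - + k) * falling (+ n - + k) q)
Cℤ-+ n k zero = begin
  n Cℤ suc k * (1ℤ * + suc k)     ≡⟨ cong (n Cℤ suc k *_) (ℤ.*-identityˡ _) ⟩
  n Cℤ suc k * + suc k            ≡⟨ Cℤ-suc n k ⟩
  n Cℤ k * (+ n - + k)            ≡⟨ cong (n Cℤ k *_) (ℤ.*-identityʳ _) ⟨
  n Cℤ k * ((+ n - + k) * 1ℤ)     ∎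
  where open ≡-Reasoning
Cℤ-+ n k (suc q) = begin
  c₂ * (R * (+ k + + suc q) * + suc (suc q ℕ.+ k))
    ≡⟨ cong (λ z → c₂ * (R * z * + suc (suc q ℕ.+ k))) (ℤ.+-comm (+ k) (+ suc q)) ⟩
  c₂ * (R * t * + suc (suc q ℕ.+ k))
    ≡⟨ swap c₂ R t (+ suc (suc q ℕ.+ k)) ⟩
  c₂ * + suc (suc q ℕ.+ k) * (R * t)
    ≡⟨ cong (_* (R * t)) (Cℤ-suc n (suc q ℕ.+ k)) ⟩
  c₁ * (+ n - t) * (R * t)
    ≡⟨ swap₂ c₁ (+ n - t) (R * t) ⟩
  c₁ * (R * t) * (+ n - t)
    ≡⟨ cong (_* (+ n - t)) (Cℤ-+ n k q) ⟩
  c₀ * (d * F) * (+ n - t)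
    ≡⟨ regroup c₀ (+ n) (+ k) (+ suc q) F ⟩
  c₀ * (d * (F * (d - + suc q))) ∎
  where
  open ≡-Reasoning
  c₀ = n Cℤ k
  c₁ = n Cℤ (suc q ℕ.+ k)
  c₂ = n Cℤ (suc (suc q ℕ.+ k))
  R = rising (+ k) q
  d = + n - + k
  F = falling d q
  t = + (suc q ℕ.+ k)
  swap : ∀ a b c d → a * (b * c * d) ≡ a * d * (b * c)
  swap = solve-∀
  swap₂ : ∀ a b c → a * b * c ≡ a * c * b
  swap₂ = solve-∀
  regroup : ∀ c n k s F → c * ((n - k) * F) * (n - (s + k)) ≡ c * ((n - k) * (F * ((n - k) - s)))
  regroup = solve-∀

-- Modulo n each factor n - k - i is -(k + i).
falling-reflect : ∀ n k q → n ∣ falling (n - k) q - -1ℤ ^ q * rising k q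
falling-reflect n k zero    = divides 0ℤ refl
falling-reflect n k (suc q) = subst (n ∣_)
  (sym (expand n k (+ suc q) (falling (n - k) q) (-1ℤ ^ q) (rising k q)))
  (∣m∣n⇒∣m+n (∣m⇒∣m*n (n - k - + suc q) (falling-reflect n k q)) (∣n⇒∣m*n (-1ℤ ^ q * rising k q) ∣-refl))
  where
  expand : ∀ n k s F e R → F * (n - k - s) - -1ℤ * e * (R * (k + s)) ≡ (F - e * R) * (n - k - s) + e * R * n
  expand = solve-∀

-- Integers prime to p, and C(n p, m p) against C(n, m).

euclidsLemmaℤ : ∀ {p} a b → Prime p → + p ∣ a * b → (+ p ∣ a) ⊎ (+ p ∣ b)
euclidsLemmaℤ {p} a b pp p∣ab =
  Sum.map ∣ᵤ⇒∣ ∣ᵤ⇒∣ (euclidsLemma ∣ a ∣ ∣ b ∣ pp (subst (p ℕ.∣_) (ℤ.abs-* a b) (∣⇒∣ᵤ p∣ab)))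

∤1 : ∀ {p} → Prime p → ¬ (+ p ∣ 1ℤ)
∤1 pp p∣1 with refl ← ℕ.∣1⇒≡1 (∣⇒∣ᵤ p∣1) = ¬prime[1] pp

∤-* : ∀ {p} a b → Prime p → ¬ (+ p ∣ a) → ¬ (+ p ∣ b) → ¬ (+ p ∣ a * b)
∤-* a b pp p∤a p∤b = [ p∤a , p∤b ]′ ∘ euclidsLemmaℤ a b pp

∤-rising : ∀ {p} m q → Prime p → q ℕ.< p → ¬ (+ p ∣ rising (+ (m ℕ.* p)) q)
∤-rising     m zero    pp q<p = ∤1 pp
∤-rising {p} m (suc q) pp q<p = ∤-* (rising (+ (m ℕ.* p)) q) (+ (m ℕ.* p) + + suc q) pp
  (∤-rising m q pp (ℕ.<-trans (ℕ.n<1+n q) q<p))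
  (λ p∣ → ℕ.>⇒∤ q<p (ℕ.∣m+n∣m⇒∣n (∣⇒∣ᵤ p∣) (ℕ.n∣m*n m)))

-- `J` and `J′` are what is left of the denominator and the numerator of C(n p, m p) once the
-- factors divisible by p, which make up C(n, m), are cancelled. Each step of the induction on `m`
-- adds p - 1 factors to both, and reflecting those of `J′` modulo n p contributes the sign (-1)^q.
Cℤ-*-prime : ∀ q → Prime (suc q) → ∀ n m → let p = suc q in
  ∃₂ λ J J′ →
    ((n ℕ.* p) Cℤ (m ℕ.* p) * J ≡ n Cℤ m * J′) ×
    (¬ (+ p ∣ J)) ×
    (+ (n ℕ.* p) ∣ J′ - -1ℤ ^ (m ℕ.* q) * J)
Cℤ-*-prime q pp n zero =
  1ℤ , 1ℤ , cong (λ c → + c * 1ℤ) (trans (nC0≡1 (n ℕ.* suc q)) (sym (nC0≡1 n))) , ∤1 pp , divides 0ℤ refl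
Cℤ-*-prime q pp n (suc m) with J , J′ , eq , p∤J , J′≡J ← Cℤ-*-prime q pp n m =
  A * J , B * J′ , eq′ , ∤-* A J pp (∤-rising m q pp (ℕ.n<1+n q)) p∤J , N∣BJ′
  where
  p = suc q
  N = n ℕ.* p
  M = m ℕ.* p
  A = rising (+ M) q
  B = falling (+ N - + M) q
  c₀ = N Cℤ M
  c₁ = N Cℤ (p ℕ.+ M)
  d₀ = n Cℤ m
  d₁ = n Cℤ suc m

  N∣BJ′ : + N ∣ B * J′ - -1ℤ ^ (q ℕ.+ m ℕ.* q) * (A * J)
  N∣BJ′ = subst (+ N ∣_)
    (trans (expand A B J J′ (-1ℤ ^ q) (-1ℤ ^ (m ℕ.* q)))
      (cong (λ e → B * J′ - e * (A * J)) (sym (ℤ.^-distribˡ-+-* -1ℤ q (m ℕ.* q)))))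
    (∣m∣n⇒∣m+n (∣n⇒∣m*n B J′≡J) (∣n⇒∣m*n (-1ℤ ^ (m ℕ.* q) * J) (falling-reflect (+ N) (+ M) q)))
    where
    expand : ∀ A B J J′ a b → B * (J′ - b * J) + b * J * (B - a * A) ≡ B * J′ - a * b * (A * J)
    expand = solve-∀

  eq′ : c₁ * (A * J) ≡ d₁ * (B * J′)
  -- The cancelled factor p + M is (m + 1) p. One block of p steps for C(n p, ·) is matched with a
  -- single step for C(n, ·), the common p passing from (n - m) p to (m + 1) p.
  eq′ = ℤ.*-cancelʳ-≡ (c₁ * (A * J)) (d₁ * (B * J′)) (+ (p ℕ.+ M)) (begin
    c₁ * (A * J) * + (p ℕ.+ M)               ≡⟨ swap c₁ A J (+ (p ℕ.+ M)) ⟩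
    c₁ * (A * + (p ℕ.+ M)) * J               ≡⟨ cong (_* J) (Cℤ-+ N M q) ⟩
    c₀ * ((+ N - + M) * B) * J
      ≡⟨ cong₂ (λ x y → c₀ * ((x - y) * B) * J) (ℤ.pos-* n p) (ℤ.pos-* m p) ⟩
    c₀ * ((+ n * + p - + m * + p) * B) * J   ≡⟨ swap₂ c₀ (+ n) (+ m) (+ p) B J ⟩
    c₀ * J * ((+ n - + m) * + p * B)         ≡⟨ cong (_* ((+ n - + m) * + p * B)) eq ⟩
    d₀ * J′ * ((+ n - + m) * + p * B)        ≡⟨ swap₃ d₀ J′ (+ n - + m) (+ p) B ⟩
    d₀ * (+ n - + m) * (+ p * (B * J′))      ≡⟨ cong (_* (+ p * (B * J′))) (Cℤ-suc n m) ⟨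
    d₁ * + suc m * (+ p * (B * J′))          ≡⟨ swap₄ d₁ (+ suc m) (+ p) (B * J′) ⟩
    d₁ * (B * J′) * (+ suc m * + p)          ≡⟨ cong (d₁ * (B * J′) *_) (ℤ.pos-* (suc m) p) ⟨
    d₁ * (B * J′) * + (p ℕ.+ M)              ∎)
    where
    open ≡-Reasoning
    swap : ∀ a b c d → a * (b * c) * d ≡ a * (b * d) * c
    swap = solve-∀
    swap₂ : ∀ c n m p B J → c * ((n * p - m * p) * B) * J ≡ c * J * ((n - m) * p * B)
    swap₂ = solve-∀
    swap₃ : ∀ d J x p B → d * J * (x * p * B) ≡ d * x * (p * (B * J))
    swap₃ = solve-∀
    swap₄ : ∀ d s p x → d * s * (p * x) ≡ d * x * (s * p)
    swap₄ = solve-∀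

-- Divisibility locally at a prime, and the congruence for C(n p, m p).

-- Over the ring of integers localised at p, the image of k divides the image of x.
LocallyDivides : ℕ → ℕ → ℤ → Set
LocallyDivides p k x = ∃ λ c → (¬ (+ p ∣ c)) × (+ k ∣ c * x)

-1^-parity : ∀ e → (2 ℕ.∣ e × -1ℤ ^ e ≡ 1ℤ) ⊎ (2 ℕ.∣ suc e × -1ℤ ^ e ≡ -1ℤ)
-1^-parity zero    = inj₁ (2 ℕ.∣0 , refl)
-1^-parity (suc e) with -1^-parity e
... | inj₁ (2∣e  , eq) = inj₂ (ℕ.∣m∣n⇒∣m+n (ℕ.∣-refl {2}) 2∣e , cong (-1ℤ *_) eq)
... | inj₂ (2∣1+e , eq) = inj₁ (2∣1+e , cong (-1ℤ *_) eq)

even-suc⇒odd : ∀ {e} → 2 ℕ.∣ suc e → ¬ 2 ℕ.∣ e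
even-suc⇒odd {e} 2∣1+e 2∣e with () ← ℕ.∣1⇒≡1 (ℕ.∣m+n∣m⇒∣n (subst (2 ℕ.∣_) (ℕ.+-comm 1 e) 2∣1+e) 2∣e)

even-prime : ∀ {p} → Prime p → 2 ℕ.∣ p → p ≡ 2
even-prime pp 2∣p with prime⇒irreducible pp 2∣p
... | inj₂ 2≡p = sym 2≡p

-- Since b J = d J′, the product J (b - d) equals d (J′ - J), which n p divides if (-1)^(m q) = 1;
-- then J is the multiplier. For the other sign the multiplier is m J.
Cℤ-*-prime-≡ : ∀ q → Prime (suc q) → ∀ n m → let p = suc q in
  LocallyDivides p (n ℕ.* p) ((n ℕ.* p) Cℤ (m ℕ.* p) - n Cℤ m)
Cℤ-*-prime-≡ q pp n m with J , J′ , eq , p∤J , N∣ ← Cℤ-*-prime q pp n m = [ even , odd ]′ (-1^-parity (m ℕ.* q))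
  where
  p = suc q
  N = + (n ℕ.* p)
  b = (n ℕ.* p) Cℤ (m ℕ.* p)
  d = n Cℤ m

  N∣[-1^]≡ : ∀ {ε} → -1ℤ ^ (m ℕ.* q) ≡ ε → N ∣ d * (J′ - ε * J)
  N∣[-1^]≡ refl = ∣n⇒∣m*n d N∣

  even : 2 ℕ.∣ m ℕ.* q × -1ℤ ^ (m ℕ.* q) ≡ 1ℤ → LocallyDivides p (n ℕ.* p) (b - d)
  even (_ , ε≡1) = J , p∤J , subst (N ∣_) (sym J[b-d]≡) (N∣[-1^]≡ ε≡1)
    where
    expand : ∀ J b d → J * (b - d) ≡ b * J - d * J
    expand = solve-∀
    factor : ∀ d J J′ → d * J′ - d * J ≡ d * (J′ - 1ℤ * J)
    factor = solve-∀
    J[b-d]≡ : J * (b - d) ≡ d * (J′ - 1ℤ * J)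
    J[b-d]≡ = trans (expand J b d) (trans (cong (_- d * J) eq) (factor d J J′))

  -- The sign −1 occurs only for p = 2 and m odd; then 2 n ∣ 2 m C(n, m) absorbs the sign.
  odd : 2 ℕ.∣ suc (m ℕ.* q) × -1ℤ ^ (m ℕ.* q) ≡ -1ℤ → LocallyDivides p (n ℕ.* p) (b - d)
  odd (2∣1+mq , ε≡-1) =
    + m * J , ∤-* (+ m) J pp (2∤m ∘ subst (ℕ._∣ m) p≡2 ∘ ∣⇒∣ᵤ) p∤J ,
    subst (N ∣_) (sym mJ[b-d]≡) (∣m∣n⇒∣m-n (∣n⇒∣m*n (+ m) (N∣[-1^]≡ ε≡-1)) (∣n⇒∣m*n J N∣2md))
    where
    2∤mq : ¬ 2 ℕ.∣ m ℕ.* q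
    2∤mq = even-suc⇒odd 2∣1+mq
    2∤m : ¬ 2 ℕ.∣ m
    2∤m = 2∤mq ∘ ℕ.∣m⇒∣m*n q
    p≡2 : p ≡ 2
    p≡2 with -1^-parity q
    ... | inj₁ (2∣q , _)   = contradiction (ℕ.∣n⇒∣m*n m 2∣q) 2∤mq
    ... | inj₂ (2∣1+q , _) = even-prime pp 2∣1+q
    N∣2md : N ∣ + m * d * + 2
    N∣2md = subst₂ _∣_
      (trans (sym (ℤ.pos-* n 2)) (cong (λ x → + (n ℕ.* x)) (sym p≡2)))
      (cong (_* + 2) (ℤ.pos-* m _))
      (*-monoˡ-∣ (+ 2) (∣ᵤ⇒∣ {+ n} {+ (m ℕ.* (n C m))} (n∣k*nCk n m)))
    expand : ∀ m J b d → m * J * (b - d) ≡ m * (b * J) - m * (d * J)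
    expand = solve-∀
    factor : ∀ m d J J′ → m * (d * J′) - m * (d * J) ≡ m * (d * (J′ - -1ℤ * J)) - J * (m * d * + 2)
    factor = solve-∀
    mJ[b-d]≡ : + m * J * (b - d) ≡ + m * (d * (J′ - -1ℤ * J)) - J * (+ m * d * + 2)
    mJ[b-d]≡ = trans (expand (+ m) J b d) (trans (cong (λ x → + m * x - + m * (d * J)) eq) (factor (+ m) d J J′))

-- From local divisibility at all primes to divisibility.

∃-primeDivisor : ∀ n .{{_ : NonZero n}} → n ≢ 1 → ∃ λ p → Prime p × p ℕ.∣ n
∃-primeDivisor n n≢1 with factorise n
... | record { factors = []     ; isFactorisation = n≡1 } = contradiction n≡1 n≢1
... | record { factors = p ∷ ps ; isFactorisation = refl ; factorsPrime = pp ∷ _ } = p , pp , ℕ.m∣m*n _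

locallyDivides⇒∣ : ∀ k x .{{_ : NonZero k}} → (∀ p → Prime p → LocallyDivides p k x) → + k ∣ x
locallyDivides⇒∣ k x local = ∣ᵤ⇒∣ (subst (ℕ._∣ ∣ x ∣) g≡k (gcd[m,n]∣n k ∣ x ∣))
  where
  g = gcd k ∣ x ∣
  instance
    g≢0 : NonZero g
    g≢0 = ℕ.≢-nonZero (gcd[m,n]≢0 k ∣ x ∣ (inj₁ (ℕ.≢-nonZero⁻¹ k)))
  k/g = k ℕ./ g
  x/g = ∣ x ∣ ℕ./ g
  k/g*g≡k : k/g ℕ.* g ≡ k
  k/g*g≡k = ℕ.m/n*n≡m (gcd[m,n]∣m k ∣ x ∣)
  x/g*g≡x : x/g ℕ.* g ≡ ∣ x ∣
  x/g*g≡x = ℕ.m/n*n≡m (gcd[m,n]∣n k ∣ x ∣)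
  instance
    k/g≢0 : NonZero k/g
    k/g≢0 = ℕ.m*n≢0⇒m≢0 k/g {{subst NonZero (sym k/g*g≡k) (ℕ.≢-nonZero (ℕ.≢-nonZero⁻¹ k))}}

  -- Cancelling g in k ∣ c x leaves k/g ∣ (x/g) c, and k/g is coprime to x/g.
  k/g∣ : ∀ c → + k ∣ c * x → k/g ℕ.∣ ∣ c ∣
  k/g∣ c k∣cx = coprime-divisor (coprime-/gcd k ∣ x ∣)
    (ℕ.*-cancelʳ-∣ g (subst₂ ℕ._∣_ (sym k/g*g≡k) ∣cx∣≡ (∣⇒∣ᵤ k∣cx)))
    where
    open ≡-Reasoning
    ∣cx∣≡ : ∣ c * x ∣ ≡ x/g ℕ.* ∣ c ∣ ℕ.* g
    ∣cx∣≡ = begin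
      ∣ c * x ∣                    ≡⟨ ℤ.abs-* c x ⟩
      ∣ c ∣ ℕ.* ∣ x ∣              ≡⟨ cong (∣ c ∣ ℕ.*_) x/g*g≡x ⟨
      ∣ c ∣ ℕ.* (x/g ℕ.* g)        ≡⟨ ℕ.*-assoc ∣ c ∣ x/g g ⟨
      ∣ c ∣ ℕ.* x/g ℕ.* g          ≡⟨ cong (ℕ._* g) (ℕ.*-comm ∣ c ∣ x/g) ⟩
      x/g ℕ.* ∣ c ∣ ℕ.* g          ∎

  k/g≡1 : k/g ≡ 1
  k/g≡1 with k/g ℕ.≟ 1
  ... | yes k/g≡1 = k/g≡1
  ... | no  k/g≢1
    with p , pp , p∣k/g ← ∃-primeDivisor k/g k/g≢1
    with c , p∤c , k∣cx ← local p pp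
    = contradiction (∣ᵤ⇒∣ (ℕ.∣-trans p∣k/g (k/g∣ c k∣cx))) p∤c

  g≡k : g ≡ k
  g≡k = trans (sym (ℕ.*-identityˡ g)) (trans (cong (ℕ._* g) (sym k/g≡1)) k/g*g≡k)

-- The Möbius function at s p.

μ-factors : List ℕ → ℤ
μ-factors ps = if does (unique? ps) then -1ℤ ^ length ps else 0ℤ

-- Factorisations agree up to permutation, which preserves both length and absence of repetitions.
-- So μ(s p) can be read off from p put in front of the factors of s, whatever list `factorise`
-- returns for s p.
μ-factorisation : ∀ n .{{_ : NonZero n}} (f : PrimeFactorisation n) → μ n ≡ μ-factors (factors f)
μ-factorisation n f = cong₂ (λ u l → if u then -1ℤ ^ l else 0ℤ)
  (does-⇔ (mk⇔ (unique-resp-↭ as↭bs) (unique-resp-↭ (↭-sym as↭bs))) (unique? _) (unique? _))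
  (↭-length as↭bs)
  where
  as↭bs : factors (factorise n) ↭ factors f
  as↭bs = factorisationUnique (factorise n) f

  unique-resp-↭ : ∀ {as bs} → as ↭ bs → Unique as → Unique bs
  unique-resp-↭ = Permutation.Unique-resp-↭ (setoid ℕ) ∘ ↭⇒↭ₛ

μ-factors-∈ : ∀ {p ps} → p ∈ ps → μ-factors (p ∷ ps) ≡ 0ℤ
μ-factors-∈ {p} {ps} p∈ps = cong (if_then -1ℤ ^ suc (length ps) else 0ℤ)
  (dec-false (unique? (p ∷ ps)) λ { (p∉ps ∷ _) → All¬⇒¬Any p∉ps p∈ps })

μ-factors-∉ : ∀ {p ps} → ¬ p ∈ ps → μ-factors (p ∷ ps) ≡ - μ-factors ps
μ-factors-∉ {p} {ps} p∉ps = trans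
  (cong (if_then -1ℤ ^ suc (length ps) else 0ℤ)
    (does-⇔ (mk⇔ tail (¬Any⇒All¬ ps p∉ps ∷_)) (unique? (p ∷ ps)) (unique? ps)))
  (if-neg (does (unique? ps)))
  where
  if-neg : ∀ b → (if b then -1ℤ ^ suc (length ps) else 0ℤ) ≡ - (if b then -1ℤ ^ length ps else 0ℤ)
  if-neg true  = ℤ.-1*i≡-i _
  if-neg false = refl

module _ {s p : ℕ} .{{_ : NonZero s}} .{{_ : NonZero (s ℕ.* p)}} (pp : Prime p) where

  private
    ps = factors (factorise s)

    s*p-factorisation : PrimeFactorisation (s ℕ.* p)
    s*p-factorisation = record
      { factors         = p ∷ ps
      ; isFactorisation = trans (ℕ.*-comm s p) (cong (p ℕ.*_) (isFactorisation (factorise s)))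
      ; factorsPrime    = pp ∷ factorsPrime (factorise s)
      }

  μ-*-∣ : p ℕ.∣ s → μ (s ℕ.* p) ≡ 0ℤ
  μ-*-∣ p∣s = trans (μ-factorisation (s ℕ.* p) s*p-factorisation)
    (μ-factors-∈ (factorisationHasAllPrimeFactors pp
      (subst (p ℕ.∣_) (isFactorisation (factorise s)) p∣s) (factorsPrime (factorise s))))

  μ-*-∤ : ¬ p ℕ.∣ s → μ (s ℕ.* p) ≡ - μ s
  μ-*-∤ p∤s = trans (μ-factorisation (s ℕ.* p) s*p-factorisation)
    (μ-factors-∉ λ p∈ps → p∤s (subst (p ℕ.∣_) (sym (isFactorisation (factorise s))) (∈⇒∣product {ns = ps} p∈ps)))

-- Finite sums over initial segments.

∑< : ℕ → (ℕ → ℤ) → ℤ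
∑< n f = sum (applyUpTo f n)

∑<-cong : ∀ n {f g : ℕ → ℤ} → (∀ i → f i ≡ g i) → ∑< n f ≡ ∑< n g
∑<-cong zero    f≗g = refl
∑<-cong (suc n) f≗g = cong₂ _+_ (f≗g 0) (∑<-cong n (f≗g ∘ suc))

∑<-zero : ∀ n {f : ℕ → ℤ} → (∀ i → i ℕ.< n → f i ≡ 0ℤ) → ∑< n f ≡ 0ℤ
∑<-zero zero    f≗0 = refl
∑<-zero (suc n) f≗0 = cong₂ _+_ (f≗0 0 (ℕ.s≤s ℕ.z≤n)) (∑<-zero n (λ i i<n → f≗0 (suc i) (ℕ.s≤s i<n)))

∑<-+ : ∀ n f g → ∑< n (λ i → f i + g i) ≡ ∑< n f + ∑< n g
∑<-+ zero    f g = refl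
∑<-+ (suc n) f g = trans (cong (λ x → f 0 + g 0 + x) (∑<-+ n (f ∘ suc) (g ∘ suc))) (interchange (f 0) (g 0) _ _)
  where
  interchange : ∀ a b c d → a + b + (c + d) ≡ a + c + (b + d)
  interchange = solve-∀

∑<-++ : ∀ m n f → ∑< (m ℕ.+ n) f ≡ ∑< m f + ∑< n (λ i → f (m ℕ.+ i))
∑<-++ zero    n f = sym (ℤ.+-identityˡ _)
∑<-++ (suc m) n f = trans (cong (_+_ (f 0)) (∑<-++ m n (f ∘ suc))) (sym (ℤ.+-assoc (f 0) _ _))

∑<-last : ∀ n f → (∀ i → i ℕ.< n → f i ≡ 0ℤ) → ∑< (suc n) f ≡ f n
∑<-last zero    f f≗0 = ℤ.+-identityʳ (f 0)
∑<-last (suc n) f f≗0 = trans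
  (cong₂ _+_ (f≗0 0 (ℕ.s≤s ℕ.z≤n)) (∑<-last n (f ∘ suc) (λ i i<n → f≗0 (suc i) (ℕ.s≤s i<n))))
  (ℤ.+-identityˡ _)

-- Index i stands for the number i + 1, so the multiple (j + 1) p of p = q + 1 sits at i = q + j p,
-- the last place of the j-th block of length p.
∑<-multiples : ∀ q n f → (∀ i → ¬ suc q ℕ.∣ suc i → f i ≡ 0ℤ) →
  ∑< (n ℕ.* suc q) f ≡ ∑< n (λ j → f (q ℕ.+ j ℕ.* suc q))
∑<-multiples q zero    f f≗0 = refl
∑<-multiples q (suc n) f f≗0 = begin
  ∑< (p ℕ.+ n ℕ.* p) f
    ≡⟨ ∑<-++ p (n ℕ.* p) f ⟩
  ∑< p f + ∑< (n ℕ.* p) (λ i → f (p ℕ.+ i))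
    ≡⟨ cong₂ _+_ (∑<-last q f (λ i i<q → f≗0 i (ℕ.>⇒∤ (ℕ.s≤s i<q))))
         (∑<-multiples q n (λ i → f (p ℕ.+ i)) (λ i p∤ → f≗0 (p ℕ.+ i) (p∤ ∘ shift⁻¹ i))) ⟩
  f q + ∑< n (λ j → f (p ℕ.+ (q ℕ.+ j ℕ.* p)))
    ≡⟨ cong₂ _+_ (cong f (sym (ℕ.+-identityʳ q))) (∑<-cong n (λ j → cong f (swap j))) ⟩
  f (q ℕ.+ 0) + ∑< n (λ j → f (q ℕ.+ suc j ℕ.* p)) ∎
  where
  open ≡-Reasoning
  p = suc q
  shift⁻¹ : ∀ i → p ℕ.∣ suc (p ℕ.+ i) → p ℕ.∣ suc i
  shift⁻¹ i p∣ = ℕ.∣m+n∣m⇒∣n (subst (p ℕ.∣_) (sym (ℕ.+-suc p i)) p∣) ℕ.∣-refl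
  swap : ∀ j → p ℕ.+ (q ℕ.+ j ℕ.* p) ≡ q ℕ.+ suc j ℕ.* p
  swap j = trans (sym (ℕ.+-assoc p q _)) (trans (cong (ℕ._+ j ℕ.* p) (ℕ.+-comm p q)) (ℕ.+-assoc q p _))

-- Zero terms in place of filtering keep the index range an initial segment, so that sums can be
-- split and reindexed.
restrict : ∀ {a} {A : Set a} → Dec A → ℤ → ℤ
restrict a? x = if does a? then x else 0ℤ

restrict-yes : ∀ {a} {A : Set a} (a? : Dec A) {x} → A → restrict a? x ≡ x
restrict-yes a? {x} a = cong (if_then x else 0ℤ) (dec-true a? a)

restrict-no : ∀ {a} {A : Set a} (a? : Dec A) {x} → ¬ A → restrict a? x ≡ 0ℤ
restrict-no a? {x} ¬a = cong (if_then x else 0ℤ) (dec-false a? ¬a)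

restrict-split : ∀ {a} {A : Set a} (a? : Dec A) x → x ≡ restrict a? x + restrict (¬? a?) x
restrict-split (yes _) x = sym (ℤ.+-identityʳ x)
restrict-split (no  _) x = sym (ℤ.+-identityˡ x)

-- An arbitrary `e` is needed for the induction, which passes to `e ∘ suc`; `upTo n` is the case
-- `e = id`.
sum-filter : ∀ {ℓ} {P : Pred ℕ ℓ} (P? : Decidable P) (h : ℕ → ℤ) (e : ℕ → ℕ) n →
  sum (map h (filter P? (applyUpTo e n))) ≡ ∑< n (λ i → restrict (P? (e i)) (h (e i)))
sum-filter P? h e zero    = refl
sum-filter P? h e (suc n) with does (P? (e 0))
... | true  = cong (_+_ (h (e 0))) (sum-filter P? h (e ∘ suc) n)
... | false = trans (sum-filter P? h (e ∘ suc) n) (sym (ℤ.+-identityˡ _))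

-- Closure properties of local divisibility.

module _ {p k : ℕ} (pp : Prime p) where

  locallyDivides-0 : LocallyDivides p k 0ℤ
  locallyDivides-0 = 1ℤ , ∤1 pp , divides 0ℤ refl

  locallyDivides-+ : ∀ {x y} → LocallyDivides p k x → LocallyDivides p k y → LocallyDivides p k (x + y)
  locallyDivides-+ {x} {y} (c , p∤c , k∣cx) (d , p∤d , k∣dy) = c * d , ∤-* c d pp p∤c p∤d ,
    subst (+ k ∣_) (expand c d x y) (∣m∣n⇒∣m+n (∣n⇒∣m*n d k∣cx) (∣n⇒∣m*n c k∣dy))
    where
    expand : ∀ c d x y → d * (c * x) + c * (d * y) ≡ c * d * (x + y)
    expand = solve-∀

  locallyDivides-∑< : ∀ n {f} → (∀ i → LocallyDivides p k (f i)) → LocallyDivides p k (∑< n f)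
  locallyDivides-∑< zero    k∣f = locallyDivides-0
  locallyDivides-∑< (suc n) k∣f = locallyDivides-+ (k∣f 0) (locallyDivides-∑< n (k∣f ∘ suc))

  locallyDivides-restrict : ∀ {a} {A : Set a} (a? : Dec A) {x} →
    (A → LocallyDivides p k x) → LocallyDivides p k (restrict a? x)
  locallyDivides-restrict (yes a) k∣x = k∣x a
  locallyDivides-restrict (no  _) k∣x = locallyDivides-0

locallyDivides-* : ∀ {p k} x y → LocallyDivides p k x → LocallyDivides p k (x * y)
locallyDivides-* {k = k} x y (c , p∤c , k∣cx) = c , p∤c , subst (+ k ∣_) (ℤ.*-assoc c x y) (∣m⇒∣m*n y k∣cx)

-- Locally at p the number s is a unit; the multiplier c becomes c s.
locallyDivides-*-coprime : ∀ {p k s x} → Prime p → ¬ p ℕ.∣ s → LocallyDivides p k x → LocallyDivides p (k ℕ.* s) x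
locallyDivides-*-coprime {p} {k} {s} {x} pp p∤s (c , p∤c , k∣cx) = c * + s , ∤-* c (+ s) pp p∤c (p∤s ∘ ∣⇒∣ᵤ) ,
  subst₂ _∣_ (sym (ℤ.pos-* k s)) (swap c x (+ s)) (*-monoˡ-∣ (+ s) {+ k} {c * x} k∣cx)
  where
  swap : ∀ c x s → c * x * s ≡ c * s * x
  swap = solve-∀

-- Divisor sums, and the pairing of s with s p.

prime∤⇒coprime : ∀ {p n} → Prime p → ¬ p ℕ.∣ n → Coprime n p
prime∤⇒coprime pp p∤n (d∣n , d∣p) with prime⇒irreducible pp d∣p
... | inj₁ d≡1  = d≡1
... | inj₂ refl = contradiction d∣n p∤n

∣-*-prime : ∀ {p s n} → Prime p → ¬ p ℕ.∣ s → s ℕ.∣ n ℕ.* p → s ℕ.∣ n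
∣-*-prime {p} {s} {n} pp p∤s s∣np = coprime-divisor (prime∤⇒coprime pp p∤s) (subst (s ℕ.∣_) (ℕ.*-comm n p) s∣np)

module _ (F : (s : ℕ) .{{_ : NonZero s}} → ℤ) where

  -- The summand of s = suc i, extended by zero to the non-divisors of n.
  private
    term : ℕ → ℕ → ℤ
    term n i = restrict (suc i ℕ.∣? n) (F (suc i))

  ∑-divisors≡∑< : ∀ n → ∑-divisors n F ≡ ∑< n (term n)
  ∑-divisors≡∑< n = sum-filter (λ i → suc i ℕ.∣? n) (λ i → F (suc i)) id n

  locallyDivides-∑-divisors : ∀ {p k} → Prime p → ∀ n →
    (∀ s .{{_ : NonZero s}} → s ℕ.∣ n → LocallyDivides p k (F s)) →
    LocallyDivides p k (∑-divisors n F)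
  locallyDivides-∑-divisors {p} {k} pp n k∣F = subst (LocallyDivides p k) (sym (∑-divisors≡∑< n))
    (locallyDivides-∑< pp n (λ i → locallyDivides-restrict pp (suc i ℕ.∣? n) (k∣F (suc i))))

  module _ {q k : ℕ} (pp : Prime (suc q)) (n : ℕ) where

    private
      p = suc q

      D : ℕ → ℤ
      D = term (n ℕ.* p)

      multiple nonmultiple : ℕ → ℤ
      multiple    i = restrict (p ℕ.∣? suc i) (D i)
      nonmultiple i = restrict (¬? (p ℕ.∣? suc i)) (D i)

    nonmultiple-∣ : ∀ i → p ℕ.∣ suc i → nonmultiple i ≡ 0ℤ
    nonmultiple-∣ i p∣s = restrict-no (¬? (p ℕ.∣? suc i)) (λ p∤s → p∤s p∣s)

    nonmultiple-∤ : ∀ i → ¬ p ℕ.∣ suc i → nonmultiple i ≡ D i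
    nonmultiple-∤ i p∤s = restrict-yes (¬? (p ℕ.∣? suc i)) p∤s

    -- A divisor of n p that is prime to p already divides n.
    nonmultiple-0 : ∀ i → ¬ suc i ℕ.∣ n → nonmultiple i ≡ 0ℤ
    nonmultiple-0 i s∤n = byCases (p ℕ.∣? suc i)
      where
      byCases : Dec (p ℕ.∣ suc i) → nonmultiple i ≡ 0ℤ
      byCases (yes p∣s) = nonmultiple-∣ i p∣s
      byCases (no  p∤s) = trans (nonmultiple-∤ i p∤s) (restrict-no (suc i ℕ.∣? n ℕ.* p) (s∤n ∘ ∣-*-prime pp p∤s))

    -- The multiples of p up to n p are the s p with s ≤ n, while the divisors of n p prime to p
    -- divide n and so are at most n. Both sums therefore run over s = j + 1 ≤ n.
    ∑-divisors-pairs : .{{n≢0 : NonZero n}} →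
      ∑-divisors (n ℕ.* p) F ≡ ∑< n (λ j → multiple (q ℕ.+ j ℕ.* p) + nonmultiple j)
    ∑-divisors-pairs {{n≢0}} = begin
      ∑-divisors (n ℕ.* p) F
        ≡⟨ ∑-divisors≡∑< (n ℕ.* p) ⟩
      ∑< (n ℕ.* p) D
        ≡⟨ ∑<-cong (n ℕ.* p) (λ i → restrict-split (p ℕ.∣? suc i) (D i)) ⟩
      ∑< (n ℕ.* p) (λ i → multiple i + nonmultiple i)
        ≡⟨ ∑<-+ (n ℕ.* p) multiple nonmultiple ⟩
      ∑< (n ℕ.* p) multiple + ∑< (n ℕ.* p) nonmultiple
        ≡⟨ cong₂ _+_ (∑<-multiples q n multiple (λ i → restrict-no (p ℕ.∣? suc i)))
             drop-tail ⟩
      ∑< n (λ j → multiple (q ℕ.+ j ℕ.* p)) + ∑< n nonmultiple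
        ≡⟨ ∑<-+ n (λ j → multiple (q ℕ.+ j ℕ.* p)) nonmultiple ⟨
      ∑< n (λ j → multiple (q ℕ.+ j ℕ.* p) + nonmultiple j) ∎
      where
      open ≡-Reasoning
      drop-tail : ∑< (n ℕ.* p) nonmultiple ≡ ∑< n nonmultiple
      drop-tail = begin
        ∑< (n ℕ.* p) nonmultiple
          ≡⟨ cong (λ m → ∑< m nonmultiple) (ℕ.*-suc n q) ⟩
        ∑< (n ℕ.+ n ℕ.* q) nonmultiple
          ≡⟨ ∑<-++ n (n ℕ.* q) nonmultiple ⟩
        ∑< n nonmultiple + ∑< (n ℕ.* q) (λ i → nonmultiple (n ℕ.+ i))
          ≡⟨ cong (_+_ (∑< n nonmultiple)) (∑<-zero (n ℕ.* q)
               (λ i _ → nonmultiple-0 (n ℕ.+ i) (ℕ.>⇒∤ {{n≢0}} (ℕ.s≤s (ℕ.m≤m+n n i))))) ⟩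
        ∑< n nonmultiple + 0ℤ
          ≡⟨ ℤ.+-identityʳ _ ⟩
        ∑< n nonmultiple ∎

    -- For s = j + 1 both terms of the pair vanish if s ∤ n. If s ∣ n, only the term at s p survives
    -- when p ∣ s, and both survive otherwise. The hypotheses are made for a factor μ in `F`, where
    -- μ(s p) is 0 or -μ(s) respectively.
    locallyDivides-pairs : .{{_ : NonZero n}} →
      (∀ j → suc j ℕ.∣ n →   p ℕ.∣ suc j → F (suc j ℕ.* p) ≡ 0ℤ) →
      (∀ j → suc j ℕ.∣ n → ¬ p ℕ.∣ suc j → LocallyDivides p k (F (suc j ℕ.* p) + F (suc j))) →
      LocallyDivides p k (∑-divisors (n ℕ.* p) F)
    locallyDivides-pairs F≡0 k∣F+F = subst (LocallyDivides p k) (sym ∑-divisors-pairs)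
      (locallyDivides-∑< pp n pair)
      where
      multiple≡D : ∀ j → multiple (q ℕ.+ j ℕ.* p) ≡ D (q ℕ.+ j ℕ.* p)
      -- `suc (q + j * p)` is `suc j * p` by computation.
      multiple≡D j = restrict-yes (p ℕ.∣? suc j ℕ.* p) (ℕ.n∣m*n (suc j))

      multiple-∣ : ∀ j → suc j ℕ.∣ n → multiple (q ℕ.+ j ℕ.* p) ≡ F (suc j ℕ.* p)
      multiple-∣ j s∣n = trans (multiple≡D j) (restrict-yes (suc j ℕ.* p ℕ.∣? n ℕ.* p) (ℕ.*-monoˡ-∣ p s∣n))

      multiple-∤ : ∀ j → ¬ suc j ℕ.∣ n → multiple (q ℕ.+ j ℕ.* p) ≡ 0ℤ
      multiple-∤ j s∤n = trans (multiple≡D j)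
        (restrict-no (suc j ℕ.* p ℕ.∣? n ℕ.* p) (s∤n ∘ ℕ.*-cancelʳ-∣ {suc j} {n} p))

      pair : ∀ j → LocallyDivides p k (multiple (q ℕ.+ j ℕ.* p) + nonmultiple j)
      pair j = byCases (suc j ℕ.∣? n) (p ℕ.∣? suc j)
        where
        byCases : Dec (suc j ℕ.∣ n) → Dec (p ℕ.∣ suc j) →
          LocallyDivides p k (multiple (q ℕ.+ j ℕ.* p) + nonmultiple j)
        byCases (no s∤n)  _         = subst (LocallyDivides p k)
          (sym (cong₂ _+_ (multiple-∤ j s∤n) (nonmultiple-0 j s∤n))) (locallyDivides-0 pp)
        byCases (yes s∣n) (yes p∣s) = subst (LocallyDivides p k)
          (sym (cong₂ _+_ (trans (multiple-∣ j s∣n) (F≡0 j s∣n p∣s)) (nonmultiple-∣ j p∣s))) (locallyDivides-0 pp)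
        byCases (yes s∣n) (no p∤s)  = subst (LocallyDivides p k)
          (sym (cong₂ _+_ (multiple-∣ j s∣n)
            (trans (nonmultiple-∤ j p∤s) (restrict-yes (suc j ℕ.∣? n ℕ.* p) (ℕ.∣m⇒∣m*n p s∣n)))))
          (k∣F+F j s∣n p∤s)

-- The congruence modulo k.

corollary1 : (k r : ℕ) → 2 ≤ k → 1 ≤ r → r ≤ k →
    + k ∣ ∑-divisors (gcd k r) (λ s → + ((k / s) C (r / s)) * μ s)
corollary1 zero      r () _ _
corollary1 k@(suc _) r _  _ _ = locallyDivides⇒∣ k _ local
  where
  F : (s : ℕ) .{{_ : NonZero s}} → ℤ
  F s = (k / s) Cℤ (r / s) * μ s

  LD : ℕ → Set
  LD p = LocallyDivides p k (∑-divisors (gcd k r) F)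

  termwise : ∀ {p} → Prime p → ¬ p ℕ.∣ gcd k r → LD p
  termwise {p} pp p∤g = locallyDivides-∑-divisors F pp (gcd k r) λ s s∣g →
    locallyDivides-* ((k / s) Cℤ (r / s)) (μ s)
      (byCases s (ℕ.∣-trans s∣g (gcd[m,n]∣m k r)) (ℕ.∣-trans s∣g (gcd[m,n]∣n k r)) (p ℕ.∣? k))
    where
    byCases : ∀ s .{{_ : NonZero s}} → s ℕ.∣ k → s ℕ.∣ r → Dec (p ℕ.∣ k) → LocallyDivides p k ((k / s) Cℤ (r / s))
    byCases s s∣k s∣r (no  p∤k) = + k , p∤k ∘ ∣⇒∣ᵤ , ∣m⇒∣m*n _ ∣-refl
    -- Here p ∤ r, as p divides k but not the gcd. Since k/s divides (r/s) C(k/s, r/s), multiplying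
    -- by s gives k ∣ r C(k/s, r/s).
    byCases s s∣k s∣r (yes p∣k) =
      + r , (λ p∣r → p∤g (gcd-greatest p∣k (∣⇒∣ᵤ p∣r))) ,
      ∣ᵤ⇒∣ (subst₂ ℕ._∣_ (ℕ.m/n*n≡m s∣k) r*C≡ (ℕ.*-monoˡ-∣ s (n∣k*nCk (k / s) (r / s))))
      where
      open ≡-Reasoning
      c = (k / s) C (r / s)
      r*C≡ : r / s ℕ.* c ℕ.* s ≡ ∣ + r * + c ∣
      r*C≡ = begin
        r / s ℕ.* c ℕ.* s      ≡⟨ swap (r / s) c s ⟩
        r / s ℕ.* s ℕ.* c      ≡⟨ cong (ℕ._* c) (ℕ.m/n*n≡m s∣r) ⟩
        r ℕ.* c                ≡⟨ ℤ.abs-* (+ r) (+ c) ⟨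
        ∣ + r * + c ∣          ∎
        where
        swap : ∀ a b c → a ℕ.* b ℕ.* c ≡ a ℕ.* c ℕ.* b
        swap = ℕ.solve-∀

  paired : ∀ {q} → Prime (suc q) → suc q ℕ.∣ gcd k r → LD (suc q)
  paired {q} pp (ℕ.divides n g≡np) = subst (λ g → LocallyDivides p k (∑-divisors g F)) (sym g≡np)
    (locallyDivides-pairs F pp n {{n≢0}} F≡0 k∣F+F)
    where
    p = suc q
    n≢0 : NonZero n
    n≢0 = ℕ.m*n≢0⇒m≢0 n {{subst NonZero g≡np (ℕ.≢-nonZero (gcd[m,n]≢0 k r (inj₁ λ ())))}}

    F≡0 : ∀ j → suc j ℕ.∣ n → p ℕ.∣ suc j → F (suc j ℕ.* p) ≡ 0ℤ
    F≡0 j _ p∣s = trans (cong (c *_) (μ-*-∣ {suc j} pp p∣s)) (ℤ.*-zeroʳ c)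
      where
      c = (k / (suc j ℕ.* p)) Cℤ (r / (suc j ℕ.* p))

    k∣F+F : ∀ j → suc j ℕ.∣ n → ¬ p ℕ.∣ suc j → LocallyDivides p k (F (suc j ℕ.* p) + F (suc j))
    -- With k = a p s and r = e p s the pair is (C(a p, e p) - C(a, e)) μ(s). Locally a p divides
    -- the bracket, and the unit s turns a p into k.
    k∣F+F j s∣n p∤s = subst₂ (LocallyDivides p) (sym k≡aps) (sym F+F≡)
      (locallyDivides-* (b - d) (μ s) (locallyDivides-*-coprime pp p∤s (Cℤ-*-prime-≡ q pp a e)))
      where
      open ≡-Reasoning
      s = suc j
      sp∣g : s ℕ.* p ℕ.∣ gcd k r
      sp∣g = subst (s ℕ.* p ℕ.∣_) (sym g≡np) (ℕ.*-monoˡ-∣ p s∣n)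
      a = k / (s ℕ.* p)
      e = r / (s ℕ.* p)
      b = (a ℕ.* p) Cℤ (e ℕ.* p)
      d = a Cℤ e

      split : ∀ {x} → s ℕ.* p ℕ.∣ x → x ≡ x / (s ℕ.* p) ℕ.* p ℕ.* s
      split {x} sp∣x = begin
        x                                ≡⟨ ℕ.m/n*n≡m sp∣x ⟨
        x / (s ℕ.* p) ℕ.* (s ℕ.* p)      ≡⟨ cong (x / (s ℕ.* p) ℕ.*_) (ℕ.*-comm s p) ⟩
        x / (s ℕ.* p) ℕ.* (p ℕ.* s)      ≡⟨ ℕ.*-assoc (x / (s ℕ.* p)) p s ⟨
        x / (s ℕ.* p) ℕ.* p ℕ.* s        ∎

      x/s≡ : ∀ {x} → s ℕ.* p ℕ.∣ x → x / s ≡ x / (s ℕ.* p) ℕ.* p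
      x/s≡ {x} sp∣x = trans (ℕ./-congˡ (split sp∣x)) (ℕ.m*n/n≡m (x / (s ℕ.* p) ℕ.* p) s)

      k≡aps : k ≡ a ℕ.* p ℕ.* s
      k≡aps = split (ℕ.∣-trans sp∣g (gcd[m,n]∣m k r))

      F+F≡ : F (s ℕ.* p) + F s ≡ (b - d) * μ s
      F+F≡ = begin
        d * μ (s ℕ.* p) + (k / s) Cℤ (r / s) * μ s
          ≡⟨ cong₂ (λ x y → d * x + y * μ s) (μ-*-∤ {s} pp p∤s)
               (cong₂ _Cℤ_ (x/s≡ (ℕ.∣-trans sp∣g (gcd[m,n]∣m k r))) (x/s≡ (ℕ.∣-trans sp∣g (gcd[m,n]∣n k r)))) ⟩
        d * - μ s + b * μ s
          ≡⟨ collect d b (μ s) ⟩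
        (b - d) * μ s ∎
        where
        collect : ∀ d b m → d * - m + b * m ≡ (b - d) * m
        collect = solve-∀

  local : ∀ p → Prime p → LD p
  local zero    pp = contradiction pp ¬prime[0]
  local (suc q) pp with suc q ℕ.∣? gcd k r
  ... | yes p∣g = paired pp p∣g
  ... | no  p∤g = termwise pp p∤g
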